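{- Let $\mathcal{D}$ be a sequence of integers greater than or equal to $2$ and let $\alpha$ be a real number such that the pair $(\alpha,\mathcal{D})$ is a counterexample to the mixed Littlewood conjecture, i.e. such that $$\inf_{q\ge1}\; q\cdot\Vert q\alpha\Vert\cdot|q|_{\mathcal{D}}>0,$$ where the infimum is over positive integers $q$. Then the complexity function of $\alpha$ satisfies $$\lim_{n\to+\infty}\bigl(p(n,\alpha)-n\bigr)=+\infty.$$
   Context: $\Vert x\Vert$ denotes the distance from the real number $x$ to the nearest integer. For a sequence $\mathcal{D}=(d_k)_{k\ge1}$ of integers $\ge2$ set $e_0=1$ and $e_n=\prod_{1\le k\le n}d_k$ for $n\ge1$; for a positive integer $q$ set $w_{\mathcal{D}}(q)=\sup\{n\ge0: q\in e_n\mathbf{Z}\}$ and $|q|_{\mathcal{D}}=1/e_{w_{\mathcal{D}}(q)}=\inf\{1/e_n: q\in e_n\mathbf{Z}\}$. A real number $\alpha$ is badly approximable if $\inf_{q\ge1}q\Vert q\alpha\Vert>0$ (equivalently, irrational with bounded partial quotients); since $|q|_{\mathcal{D}}\le1$, any $\alpha$ as in the claim is badly approximable. For a badly approximable $\alpha=[a_0;a_1,a_2,\ldots]$ (continued fraction expansion), the complexity function is $p(n,\alpha)=\mathrm{Card}\{(a_{\ell+1},\ldots,a_{\ell+n}):\ell\ge0\}$, $n\ge1$, the number of distinct blocks of $n$ consecutive letters of the infinite word $a_1a_2\ldots$. -}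

module Defs where

open import Data.Fin using (toℕ)
open import Data.Integer as ℤ using (ℤ; +_)
import Data.Integer.DivMod as ℤ
open import Data.Integer.GCD using (gcd)
import Data.Integer.Properties as ℤ
open import Data.List using (List; length)
open import Data.List.Membership.Propositional using (_∈_)
open import Data.List.Relation.Unary.Unique.Propositional using (Unique)
open import Data.Nat as ℕ using (ℕ; zero; suc)
open import Data.Nat.Divisibility using (_∣_; _∣?_; 1∣_; ∣⇒≤; ∣1⇒≡1)
open import Data.Nat.GCD using (gcd[m,n]∣n)
import Data.Nat.Properties as ℕ
open import Data.Product using (Σ; ∃; _×_; _,_)
open import Data.Rational
open import Data.Rational.Properties
open import Data.Sum using (inj₁; inj₂)
open import Data.Vec using (Vec; tabulate)
open import Function using (_∘_; _⇔_)
open import Level using (0ℓ)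
open import Relation.Binary.PropositionalEquality
open import Relation.Nullary using (yes; no; contradiction)
open import Relation.Unary using (Pred)

------------------------------------------------------------------------
-- Distance from a rational to the nearest integer

‖_‖ℚ : ℚ → ℚ
‖ r ‖ℚ = ∣ r - floor r / 1 ∣ ⊓ ∣ r - ℤ.suc (floor r) / 1 ∣

/1≡ : ∀ i → ↥ (i / 1) ≡ i × ↧ (i / 1) ≡ + 1
/1≡ i = trans (sym (ℤ.*-identityʳ (↥ (i / 1)))) num , trans (sym (ℤ.*-identityʳ (↧ (i / 1)))) den
  where
  g≡1 : gcd i (+ 1) ≡ + 1
  g≡1 = cong +_ (∣1⇒≡1 (gcd[m,n]∣n ℤ.∣ i ∣ 1))
  num : ↥ (i / 1) ℤ.* + 1 ≡ i
  num = trans (cong (↥ (i / 1) ℤ.*_) (sym g≡1)) (↥-/ i 1)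
  den : ↧ (i / 1) ℤ.* + 1 ≡ + 1
  den = trans (cong (↧ (i / 1) ℤ.*_) (sym g≡1)) (↧-/ i 1)

/1-mono : ∀ {i j} → i ℤ.≤ j → i / 1 ≤ j / 1
/1-mono {i} {j} i≤j with i / 1 | j / 1 | /1≡ i | /1≡ j
... | p | q | refl , dp | refl , dq = *≤* (subst₂ ℤ._≤_ (cong (↥ p ℤ.*_) (sym dq)) (cong (↥ q ℤ.*_) (sym dp)) (ℤ.*-monoʳ-≤-nonNeg (+ 1) i≤j))

floor≤ : ∀ r → floor r / 1 ≤ r
floor≤ r@record{} with floor r / 1 | /1≡ (floor r)
... | p | n , d = *≤* (subst₂ ℤ._≤_ (cong (ℤ._* ↧ r) (sym n))
        (trans (sym (ℤ.*-identityʳ (↥ r))) (cong (↥ r ℤ.*_) (sym d)))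
        (ℤ.[n/d]*d≤n (↥ r) (↧ r)))

≤floor+1 : ∀ r → r ≤ ℤ.suc (floor r) / 1
≤floor+1 r@record{} with ℤ.suc (floor r) / 1 | /1≡ (ℤ.suc (floor r))
... | p | n , d = *≤* (subst₂ ℤ._≤_
        (trans (sym (ℤ.*-identityʳ (↥ r))) (cong (↥ r ℤ.*_) (sym d)))
        (cong (ℤ._* ↧ r) (trans (cong ℤ.suc (sym (ℤ.div-pos-is-/ℕ (↥ r) (↧ₙ r)))) (sym n)))
        (ℤ.<⇒≤ (ℤ.n<s[n/ℕd]*d (↥ r) (↧ₙ r))))

sub-nonNeg : ∀ {p q} → p ≤ q → 0ℚ ≤ q - p
sub-nonNeg {p} {q} p≤q = subst (_≤ q - p) (+-inverseʳ p) (+-monoˡ-≤ (- p) p≤q)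

swap-sub : ∀ p q → - (p - q) ≡ q - p
swap-sub p q = trans (neg-distrib-+ p (- q)) (trans (+-comm (- p) (- - q)) (cong (_- p) (⁻¹-involutive q)))
  where open import Algebra.Properties.Group +-0-group

abs-sub-comm : ∀ p q → ∣ p - q ∣ ≡ ∣ q - p ∣
abs-sub-comm p q = trans (sym (∣-p∣≡∣p∣ (p - q))) (cong ∣_∣ (swap-sub p q))

abs-mono : ∀ {r m f} → m ≤ f → f ≤ r → ∣ r - f ∣ ≤ ∣ r - m ∣
abs-mono {r} {m} {f} m≤f f≤r = subst₂ _≤_ (sym (0≤p⇒∣p∣≡p (sub-nonNeg f≤r)))
  (sym (0≤p⇒∣p∣≡p (sub-nonNeg (≤-trans m≤f f≤r)))) (+-monoʳ-≤ r (neg-antimono-≤ m≤f))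

abs-mono′ : ∀ {r m f} → f ≤ m → r ≤ f → ∣ r - f ∣ ≤ ∣ r - m ∣
abs-mono′ {r} {m} {f} f≤m r≤f = subst₂ _≤_ (abs-sub-comm f r) (abs-sub-comm m r)
  (subst₂ _≤_ (sym (0≤p⇒∣p∣≡p (sub-nonNeg r≤f)))
    (sym (0≤p⇒∣p∣≡p (sub-nonNeg (≤-trans r≤f f≤m)))) (+-monoˡ-≤ (- r) f≤m))

telescope : ∀ p q r → (p - q) + (q - r) ≡ p - r
telescope p q r = begin
  (p - q) + (q - r)   ≡⟨ +-assoc p (- q) (q - r) ⟩
  p + (- q + (q - r)) ≡⟨ cong (λ z → p + z) (sym (+-assoc (- q) q (- r))) ⟩
  p + ((- q + q) - r) ≡⟨ cong (λ z → p + (z - r)) (+-inverseˡ q) ⟩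
  p + (0ℚ - r)        ≡⟨ cong (λ z → p + z) (+-identityˡ (- r)) ⟩
  p - r               ∎
  where open ≡-Reasoning

‖‖ℚ-nearest : ∀ r m → ‖ r ‖ℚ ≤ ∣ r - m / 1 ∣
‖‖ℚ-nearest r m with m ℤ.≤? floor r
... | yes m≤f = ≤-trans (p⊓q≤p ∣ r - floor r / 1 ∣ ∣ r - ℤ.suc (floor r) / 1 ∣) (abs-mono (/1-mono m≤f) (floor≤ r))
... | no  m≰f = ≤-trans (p⊓q≤q ∣ r - floor r / 1 ∣ ∣ r - ℤ.suc (floor r) / 1 ∣) (abs-mono′ (/1-mono (ℤ.i<j⇒suc[i]≤j (ℤ.≰⇒> m≰f))) (≤floor+1 r))

‖‖ℚ-attained : ∀ r → ∃ λ m → ‖ r ‖ℚ ≡ ∣ r - m / 1 ∣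
‖‖ℚ-attained r with ⊓-sel ∣ r - floor r / 1 ∣ ∣ r - ℤ.suc (floor r) / 1 ∣
... | inj₁ eq = floor r , eq
... | inj₂ eq = ℤ.suc (floor r) , eq

‖‖ℚ-sub≤ : ∀ r s → ‖ r ‖ℚ - ‖ s ‖ℚ ≤ ∣ r - s ∣
‖‖ℚ-sub≤ r s with ‖‖ℚ-attained s
... | m , eq = begin
  ‖ r ‖ℚ - ‖ s ‖ℚ                                 ≤⟨ +-monoˡ-≤ (- ‖ s ‖ℚ) (‖‖ℚ-nearest r m) ⟩
  ∣ r - m / 1 ∣ - ‖ s ‖ℚ                          ≡⟨ cong (λ z → ∣ z ∣ - ‖ s ‖ℚ) (sym (telescope r s (m / 1))) ⟩
  ∣ (r - s) + (s - m / 1) ∣ - ‖ s ‖ℚ              ≤⟨ +-monoˡ-≤ (- ‖ s ‖ℚ) (∣p+q∣≤∣p∣+∣q∣ (r - s) (s - m / 1)) ⟩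
  (∣ r - s ∣ + ∣ s - m / 1 ∣) - ‖ s ‖ℚ            ≡⟨ cong (λ z → (∣ r - s ∣ + z) - ‖ s ‖ℚ) (sym eq) ⟩
  (∣ r - s ∣ + ‖ s ‖ℚ) - ‖ s ‖ℚ                   ≡⟨ +-assoc ∣ r - s ∣ ‖ s ‖ℚ (- ‖ s ‖ℚ) ⟩
  ∣ r - s ∣ + (‖ s ‖ℚ - ‖ s ‖ℚ)                   ≡⟨ cong (λ z → ∣ r - s ∣ + z) (+-inverseʳ ‖ s ‖ℚ) ⟩
  ∣ r - s ∣ + 0ℚ                                  ≡⟨ +-identityʳ ∣ r - s ∣ ⟩
  ∣ r - s ∣                                       ∎
  where open ≤-Reasoning

‖‖ℚ-lipschitz : ∀ r s → ∣ ‖ r ‖ℚ - ‖ s ‖ℚ ∣ ≤ ∣ r - s ∣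
‖‖ℚ-lipschitz r s with ∣p∣≡p∨∣p∣≡-p (‖ r ‖ℚ - ‖ s ‖ℚ)
... | inj₁ eq = subst (_≤ ∣ r - s ∣) (sym eq) (‖‖ℚ-sub≤ r s)
... | inj₂ eq = subst₂ _≤_ (trans (sym (swap-sub ‖ r ‖ℚ ‖ s ‖ℚ)) (sym eq))
                  (abs-sub-comm s r) (‖‖ℚ-sub≤ s r)

------------------------------------------------------------------------
-- Real numbers: Cauchy sequences of rationals, compared up to
-- arbitrarily small ε.

record ℝ : Set where
  field
    seq    : ℕ → ℚ
    cauchy : ∀ ε → 0ℚ < ε → ∃ λ N → ∀ m n → N ℕ.≤ m → N ℕ.≤ n → ∣ seq m - seq n ∣ < ε

open ℝ public

infix 4 _≤ℝ_
_≤ℝ_ : ℝ → ℝ → Set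
x ≤ℝ y = ∀ ε → 0ℚ < ε → ∃ λ N → ∀ n → N ℕ.≤ n → seq x n ≤ seq y n + ε

fromℚ : ℚ → ℝ
fromℚ r = record
  { seq    = λ _ → r
  ; cauchy = λ ε 0<ε → 0 , λ _ _ _ _ → subst (_< ε) (sym (cong ∣_∣ (+-inverseʳ r))) 0<ε
  }

infixr 7 _•_
_•_ : ℚ → ℝ → ℝ
r • x = record { seq = λ n → r * seq x n ; cauchy = c }
  where
  k : ℚ
  k = 1ℚ + ∣ r ∣
  instance
    k>0 : Positive k
    k>0 = pos+nonNeg⇒pos 1ℚ ∣ r ∣ {{∣-∣-nonNeg r}}
    k≢0 : NonZero k
    k≢0 = pos⇒nonZero k
  ∣r∣≤k : ∣ r ∣ ≤ k
  ∣r∣≤k = subst (_≤ k) (+-identityˡ ∣ r ∣) (+-monoˡ-≤ ∣ r ∣ (nonNegative⁻¹ 1ℚ))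
  scale : ∀ p q → ∣ r * p - r * q ∣ ≤ k * ∣ p - q ∣
  scale p q = begin
    ∣ r * p - r * q ∣     ≡⟨ cong (λ z → ∣ r * p + z ∣) (neg-distribʳ-* r q) ⟩
    ∣ r * p + r * - q ∣   ≡⟨ cong ∣_∣ (sym (*-distribˡ-+ r p (- q))) ⟩
    ∣ r * (p - q) ∣       ≡⟨ ∣p*q∣≡∣p∣*∣q∣ r (p - q) ⟩
    ∣ r ∣ * ∣ p - q ∣     ≤⟨ *-monoʳ-≤-nonNeg ∣ p - q ∣ {{∣-∣-nonNeg (p - q)}} ∣r∣≤k ⟩
    k * ∣ p - q ∣         ∎
    where open ≤-Reasoning
  c : ∀ ε → 0ℚ < ε → ∃ λ N → ∀ m n → N ℕ.≤ m → N ℕ.≤ n → ∣ r * seq x m - r * seq x n ∣ < ε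
  c ε 0<ε with cauchy x ((1/ k) * ε) (positive⁻¹ _ {{pos*pos⇒pos (1/ k) {{1/pos⇒pos k}} ε {{positive 0<ε}}}})
  ... | N , h = N , λ m n N≤m N≤n → ≤-<-trans (scale (seq x m) (seq x n))
    (subst (k * ∣ seq x m - seq x n ∣ <_)
      (trans (sym (*-assoc k (1/ k) ε)) (trans (cong (_* ε) (*-inverseʳ k)) (*-identityˡ ε)))
      (*-monoʳ-<-pos k (h m n N≤m N≤n)))

-- The distance to the nearest integer is 1-Lipschitz on ℚ, hence extends
-- to Cauchy sequences termwise.
‖_‖ : ℝ → ℝ
‖ x ‖ = record
  { seq    = λ n → ‖ seq x n ‖ℚ
  ; cauchy = λ ε 0<ε → let N , h = cauchy x ε 0<ε in
      N , λ m n N≤m N≤n → ≤-<-trans (‖‖ℚ-lipschitz (seq x m) (seq x n)) (h m n N≤m N≤n)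
  }

-- lim cₙ = x; the two inequalities say |cₙ - x| ≤ ε.
_⟶_ : (ℕ → ℚ) → ℝ → Set
c ⟶ x = ∀ ε → 0ℚ < ε → ∃ λ N → ∀ n → N ℕ.≤ n →
  fromℚ (c n - ε) ≤ℝ x × x ≤ℝ fromℚ (c n + ε)

-- lim f(n) = +∞
_⟶+∞ : (ℕ → ℤ) → Set
f ⟶+∞ = ∀ (M : ℤ) → ∃ λ N → ∀ n → N ℕ.≤ n → M ℤ.≤ f n

------------------------------------------------------------------------
-- The pseudo-absolute value attached to a sequence of integers ≥ 2

record Base : Set where
  field
    d   : ℕ → ℕ              -- d k is d_{k+1}
    d≥2 : ∀ k → 2 ℕ.≤ d k

module _ (𝓓 : Base) where
  open Base 𝓓

  e : ℕ → ℕ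
  e zero    = 1
  e (suc n) = e n ℕ.* d n

  n<e : ∀ n → n ℕ.< e n
  n<e zero    = ℕ.s≤s ℕ.z≤n
  n<e (suc n) = begin
    suc (suc n)         ≤⟨ ℕ.+-monoˡ-≤ (suc n) (ℕ.s≤s (ℕ.z≤n {n})) ⟩
    suc n ℕ.+ suc n     ≡⟨ cong (suc n ℕ.+_) (sym (ℕ.+-identityʳ (suc n))) ⟩
    2 ℕ.* suc n         ≡⟨ ℕ.*-comm 2 (suc n) ⟩
    suc n ℕ.* 2         ≤⟨ ℕ.*-mono-≤ (n<e n) (d≥2 n) ⟩
    e n ℕ.* d n         ∎
    where open ℕ.≤-Reasoning

  e≢0 : ∀ n → ℕ.NonZero (e n)
  e≢0 n = ℕ.>-nonZero (ℕ.≤-<-trans ℕ.z≤n (n<e n))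

  private
    search : ℕ → ℕ → ℕ
    search q zero    = zero
    search q (suc b) with e (suc b) ∣? q
    ... | yes _ = suc b
    ... | no  _ = search q b

    search-∣ : ∀ q b → e (search q b) ∣ q
    search-∣ q zero    = 1∣ q
    search-∣ q (suc b) with e (suc b) ∣? q
    ... | yes h = h
    ... | no  _ = search-∣ q b

    search-max : ∀ q b n → n ℕ.≤ b → e n ∣ q → n ℕ.≤ search q b
    search-max q zero    n n≤b _ = n≤b
    search-max q (suc b) n n≤b h with e (suc b) ∣? q
    ... | yes _ = n≤b
    ... | no ¬h with ℕ.m≤n⇒m<n∨m≡n n≤b
    ...   | inj₁ (ℕ.s≤s n≤b′) = search-max q b n n≤b′ h
    ...   | inj₂ refl         = contradiction h ¬h

  -- sup { n : eₙ ∣ q } for q ≥ 1.  As n < eₙ, only n ≤ q need be searched;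
  -- w-∣ and w-max show that the search returns the supremum.
  w : ℕ → ℕ
  w q = search q q

  w-∣ : ∀ q → e (w q) ∣ q
  w-∣ q = search-∣ q q

  w-max : ∀ q .{{_ : ℕ.NonZero q}} n → e n ∣ q → n ℕ.≤ w q
  w-max q n h = search-max q q n (ℕ.<⇒≤ (ℕ.<-≤-trans (n<e n) (∣⇒≤ h))) h

∣_∣[_] : ℕ → Base → ℚ
∣ q ∣[ 𝓓 ] = (+ 1 / e 𝓓 (w 𝓓 q)) {{e≢0 𝓓 (w 𝓓 q)}}

-- inf_{q ≥ 1} q · ‖qα‖ · |q|_𝓓 > 0, i.e. these reals have a common
-- positive lower bound.
MixedLittlewoodCounterexample : ℝ → Base → Set
MixedLittlewoodCounterexample α 𝓓 =
  ∃ λ c → 0ℚ < c × (∀ (q : ℕ) → 1 ℕ.≤ q →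
    fromℚ c ≤ℝ (+ q / 1) • ∣ q ∣[ 𝓓 ] • ‖ (+ q / 1) • α ‖)

------------------------------------------------------------------------
-- Continued fractions

record ContinuedFraction : Set where
  field
    a₀  : ℤ
    a   : ℕ → ℕ              -- a k is a_{k+1}
    a≥1 : ∀ k → 1 ℕ.≤ a k

-- [ b 0 ; b 1 , … , b n ]
cfrac : (b : ℕ → ℕ) → (∀ k → 1 ℕ.≤ b k) → ℕ → ℚ

cfrac-pos : ∀ b b≥1 n → Positive (cfrac b b≥1 n)

cfrac≢0 : ∀ b b≥1 n → NonZero (cfrac b b≥1 n)
cfrac≢0 b b≥1 n = pos⇒nonZero (cfrac b b≥1 n) {{cfrac-pos b b≥1 n}}

cfrac b b≥1 zero    = + b 0 / 1
cfrac b b≥1 (suc n) =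
  + b 0 / 1 + (1/ cfrac (b ∘ suc) (b≥1 ∘ suc) n) {{cfrac≢0 (b ∘ suc) (b≥1 ∘ suc) n}}

cfrac-pos b b≥1 zero    = normalize-pos (b 0) 1 {{_}} {{ℕ.>-nonZero (b≥1 0)}}
cfrac-pos b b≥1 (suc n) = pos+pos⇒pos
  (+ b 0 / 1) {{normalize-pos (b 0) 1 {{_}} {{ℕ.>-nonZero (b≥1 0)}}}}
  ((1/ t) {{cfrac≢0 (b ∘ suc) (b≥1 ∘ suc) n}})
  {{1/pos⇒pos t {{cfrac-pos (b ∘ suc) (b≥1 ∘ suc) n}}}}
  where
  t : ℚ
  t = cfrac (b ∘ suc) (b≥1 ∘ suc) n

module _ (cf : ContinuedFraction) where
  open ContinuedFraction cf

  -- [ a₀ ; a₁ , … , aₙ ]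
  convergent : ℕ → ℚ
  convergent zero    = a₀ / 1
  convergent (suc n) = a₀ / 1 + (1/ cfrac a a≥1 n) {{cfrac≢0 a a≥1 n}}

  -- (a_{ℓ+1}, …, a_{ℓ+n})
  block : (n ℓ : ℕ) → Vec ℕ n
  block n ℓ = tabulate λ i → a (ℓ ℕ.+ toℕ i)

  IsBlock : (n : ℕ) → Pred (Vec ℕ n) 0ℓ
  IsBlock n v = ∃ λ ℓ → v ≡ block n ℓ

_IsExpansionOf_ : ContinuedFraction → ℝ → Set
cf IsExpansionOf α = convergent cf ⟶ α

HasCardinality : {A : Set} → Pred A 0ℓ → ℕ → Set
HasCardinality {A} P k =
  Σ (List A) λ xs → Unique xs × length xs ≡ k × (∀ x → x ∈ xs ⇔ P x)

IsComplexityFunction : ContinuedFraction → (ℕ → ℕ) → Set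
IsComplexityFunction cf p = ∀ n → 1 ℕ.≤ n → HasCardinality (IsBlock cf n) (p n)

{-# OPTIONS --safe #-}

-- Suppose first that some tail of a₁a₂… (after V letters, V ≥ 1) is recurrent, and fix m = eₙ.
-- Choosing each return time of the tail to preserve more letters than have been read so far,
-- any sum of consecutive return times is again a return time, so the pigeonhole principle for the
-- rows (q_k , q_{k-1}) modulo m, which evolve by invertible steps, yields K > V with
-- (q_K , q_{K-1}) ≡ (q_V , q_{V-1}) modulo m.  Then q = q_K q_{V-1} - q_{K-1} q_V is a nonzero
-- multiple of m with |q| ‖qα‖ ≤ (q_V + q_{V-1})², a bound independent of m, and letting m grow
-- contradicts the lower bound on q ‖qα‖ |q|.
-- Hence no tail is recurrent.  Then, for every K, the long blocks at the positions 1, …, K occur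
-- at no later position, while the tail after K is not periodic and so has at least n blocks of
-- length n; altogether p(n) ≥ n + K for n large.
module Submission where

open import Defs
open import Axiom.ExcludedMiddle using (ExcludedMiddle)
open import Axiom.DoubleNegationElimination using (em⇒dne)
open import Data.Product using (∃; ∃₂; _×_; _,_; proj₁; proj₂)
open import Data.Sum using (_⊎_; inj₁; inj₂)
open import Function using (_∘_; Equivalence)
open import Level using (0ℓ)
open import Relation.Binary.PropositionalEquality
open import Relation.Nullary using (¬_; yes; no; contradiction)

-- Blocks of an infinite word, recurrence and counting.

module Words where

  open import Data.Fin as Fin using (Fin; toℕ; fromℕ<)
  open import Data.Fin.Properties using (pigeonhole; injective⇒≤; toℕ-fromℕ<)
  open import Data.List using (List; []; _∷_; length; map; lookup)
  open import Data.List.Membership.Propositional using (_∈_)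
  open import Data.List.Membership.Propositional.Properties using (∈-lookup; ∈-map⁻)
  open import Data.List.Properties using (length-map)
  open import Data.List.Relation.Unary.All as All using (All; []; _∷_)
  open import Data.List.Relation.Unary.AllPairs as AllPairs using (AllPairs; []; _∷_)
  import Data.List.Relation.Unary.AllPairs.Properties as AllPairs
  open import Data.List.Relation.Unary.Any using (index)
  open import Data.List.Relation.Unary.Any.Properties using (lookup-index)
  open import Data.List.Relation.Unary.Unique.Propositional using (Unique)
  open import Data.Nat
  open import Data.Nat.Properties
  import Data.Vec as Vec
  open import Data.Vec.Properties using (lookup∘tabulate)

  -- A record rather than a bare function type, so that the word, the length and the positions can
  -- be inferred from a proof.
  record SameBlock (a : ℕ → ℕ) (n i j : ℕ) : Set where
    constructor same-letters
    field
      letter : ∀ t → t < n → a (i + t) ≡ a (j + t)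

  open SameBlock

  -- Each prefix of the tail starting at `i` has to return only once, and the return time may grow
  -- with `n` without restriction.
  Recurrent : (ℕ → ℕ) → ℕ → Set
  Recurrent a i = ∀ n → ∃ λ k → 1 ≤ k × SameBlock a n (k + i) i

  SameBlock-sym : ∀ {a n i j} → SameBlock a n i j → SameBlock a n j i
  SameBlock-sym s .letter t t<n = sym (letter s t t<n)

  SameBlock-trans : ∀ {a n i j k} → SameBlock a n i j → SameBlock a n j k → SameBlock a n i k
  SameBlock-trans s s′ .letter t t<n = trans (letter s t t<n) (letter s′ t t<n)

  SameBlock-≤ : ∀ {a m n i j} → m ≤ n → SameBlock a n i j → SameBlock a m i j
  SameBlock-≤ m≤n s .letter t t<m = letter s t (<-≤-trans t<m m≤n)

  SameBlock-tail : ∀ {a n i j} → SameBlock a (suc n) i j → SameBlock a n (suc i) (suc j)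
  SameBlock-tail {a} {n} {i} {j} s .letter t t<n =
    subst₂ (λ x y → a x ≡ a y) (+-suc i t) (+-suc j t) (letter s (suc t) (s≤s t<n))

  -- Blocks are represented by positions where they start, so that one list can be read at several
  -- lengths `n`.
  Distinct : (ℕ → ℕ) → ℕ → List ℕ → Set
  Distinct a n = AllPairs (λ i j → ¬ SameBlock a n i j)

  Unique⇒lookup-injective : {A : Set} {xs : List A} → Unique xs → ∀ {i j} → lookup xs i ≡ lookup xs j → i ≡ j
  Unique⇒lookup-injective (x∉xs ∷ xs!) {Fin.zero}  {Fin.zero}  eq = refl
  Unique⇒lookup-injective (x∉xs ∷ xs!) {Fin.zero}  {Fin.suc j} eq = contradiction eq (All.lookup x∉xs (∈-lookup j))
  Unique⇒lookup-injective (x∉xs ∷ xs!) {Fin.suc i} {Fin.zero}  eq = contradiction (sym eq) (All.lookup x∉xs (∈-lookup i))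
  Unique⇒lookup-injective (x∉xs ∷ xs!) {Fin.suc i} {Fin.suc j} eq = cong Fin.suc (Unique⇒lookup-injective xs! eq)

  Unique⊆⇒length≤ : {A : Set} {xs ys : List A} → Unique xs → (∀ {x} → x ∈ xs → x ∈ ys) → length xs ≤ length ys
  Unique⊆⇒length≤ {xs = xs} {ys} xs! xs⊆ys = injective⇒≤ {f = f} (Unique⇒lookup-injective xs! ∘ f≡⇒)
    where
    f : Fin (length xs) → Fin (length ys)
    f i = index (xs⊆ys (∈-lookup {xs = xs} i))
    f≡⇒ : ∀ {i j} → f i ≡ f j → lookup xs i ≡ lookup xs j
    f≡⇒ {i} {j} eq = trans (lookup-index (xs⊆ys (∈-lookup {xs = xs} i)))
      (trans (cong (lookup ys) eq) (sym (lookup-index (xs⊆ys (∈-lookup {xs = xs} j)))))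

  module _ (cf : ContinuedFraction) where
    open ContinuedFraction cf

    block≡⇒SameBlock : ∀ {n i j} → block cf n i ≡ block cf n j → SameBlock a n i j
    block≡⇒SameBlock {n} {i} {j} eq .letter t t<n = begin
      a (i + t)                               ≡⟨ cong (λ s → a (i + s)) (sym (toℕ-fromℕ< t<n)) ⟩
      a (i + toℕ (fromℕ< t<n))                ≡⟨ sym (lookup∘tabulate _ (fromℕ< t<n)) ⟩
      Vec.lookup (block cf n i) (fromℕ< t<n)  ≡⟨ cong (λ v → Vec.lookup v (fromℕ< t<n)) eq ⟩
      Vec.lookup (block cf n j) (fromℕ< t<n)  ≡⟨ lookup∘tabulate _ (fromℕ< t<n) ⟩
      a (j + toℕ (fromℕ< t<n))                ≡⟨ cong (λ s → a (j + s)) (toℕ-fromℕ< t<n) ⟩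
      a (j + t)                               ∎
      where open ≡-Reasoning

    Distinct⇒length≤ : ∀ {n k} L → HasCardinality (IsBlock cf n) k → Distinct a n L → length L ≤ k
    Distinct⇒length≤ {n} L (xs , _ , refl , xs⇔) distinct =
      subst (_≤ length xs) (length-map (block cf n) L)
        (Unique⊆⇒length≤ (AllPairs.map⁺ (AllPairs.map (_∘ block≡⇒SameBlock) distinct)) λ {v} v∈ →
          let i , _ , v≡ = ∈-map⁻ (block cf n) v∈ in Equivalence.from (xs⇔ v) (i , v≡))

    -- The `length xs + 1` windows that start at `K`, `K + 1`, ... have only `length xs` possible
    -- contents.
    pigeonhole-block : ∀ {n k} K → HasCardinality (IsBlock cf n) k →
                       ∃₂ λ i j → K ≤ i × i < j × SameBlock a n i j
    pigeonhole-block {n} K (xs , _ , _ , xs⇔)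
      with pigeonhole (n<1+n (length xs)) (index ∘ mem)
      where
      mem : (i : Fin (suc (length xs))) → block cf n (K + toℕ i) ∈ xs
      mem i = Equivalence.from (xs⇔ _) (K + toℕ i , refl)
    ... | i , j , i<j , eq = K + toℕ i , K + toℕ j , m≤m+n K _ , +-monoʳ-< K i<j ,
      block≡⇒SameBlock (trans (lookup-index (Equivalence.from (xs⇔ _) (K + toℕ i , refl)))
        (trans (cong (lookup xs) eq) (sym (lookup-index (Equivalence.from (xs⇔ _) (K + toℕ j , refl))))))

  -- Lower bound for the complexity when no tail is recurrent.

  module _ (em : ExcludedMiddle 0ℓ) where

    -- By contraposition: if for every length there were a copy at some later `j`, the differences
    -- `j ∸ i` would be return times.
    ¬Recurrent⇒neverRecurs : ∀ a i → ¬ Recurrent a i → ∃ λ n → ∀ j → i < j → ¬ SameBlock a n i j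
    ¬Recurrent⇒neverRecurs a i ¬rec = em⇒dne em λ ¬never → ¬rec λ n → em⇒dne em λ ¬ret →
      ¬never (n , λ j i<j same → ¬ret (j ∸ i , m<n⇒0<n∸m i<j ,
        subst (λ k → SameBlock a n k i) (sym (m∸n+n≡m (<⇒≤ i<j))) (SameBlock-sym same)))

    module _ (cf : ContinuedFraction) (p : ℕ → ℕ) (complexity : IsComplexityFunction cf p)
             (¬rec : ∀ i → ¬ Recurrent (ContinuedFraction.a cf) (suc i)) where
      open ContinuedFraction cf

      -- If each n-block in the tail determined the next letter, two occurrences of the same
      -- n-block would be followed by the same infinite word, which would be periodic.
      special : ∀ K n → ∃₂ λ i j → K < i × K < j × SameBlock a (suc n) i j × ¬ SameBlock a (suc (suc n)) i j
      special K n = em⇒dne em λ ¬special → periodic λ K<i K<j same → em⇒dne em λ ¬same →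
        ¬special (_ , _ , K<i , K<j , same , ¬same)
        where
        periodic : ¬ (∀ {i j} → K < i → K < j → SameBlock a (suc n) i j → SameBlock a (suc (suc n)) i j)
        periodic determined with pigeonhole-block cf (suc K) (complexity (suc n) (s≤s z≤n))
        -- The first position is at least `suc K`, hence a successor. The infinite words from both
        -- positions agree, so their difference is a return time for every length at once.
        ... | suc i , j , K<i , i<j , same = ¬rec i λ _ → j ∸ suc i , m<n⇒0<n∸m i<j ,
          same-letters λ t _ → trans (cong (λ k → a (k + t)) (m∸n+n≡m (<⇒≤ i<j))) (sym (follow K<i (<-trans K<i i<j) same t))
          where
          follow : ∀ {i j} → K < i → K < j → SameBlock a (suc n) i j → ∀ t → a (i + t) ≡ a (j + t)
          follow K<i K<j same zero    = letter same 0 z<s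
          -- The window slides by one: `determined` adds a letter on the right and `SameBlock-tail`
          -- drops one on the left.
          follow {i} {j} K<i K<j same (suc t) = subst₂ (λ x y → a x ≡ a y) (sym (+-suc i t)) (sym (+-suc j t))
            (follow (m<n⇒m<1+n K<i) (m<n⇒m<1+n K<j) (SameBlock-tail (determined K<i K<j same)) t)

      -- The two positions from `special` extend one n-block differently, so at least one of them
      -- carries an (n+1)-block not yet represented in the list.
      distinct-tail : ∀ K n → ∃ λ L → All (K <_) L × Distinct a (suc n) L × length L ≡ suc n
      distinct-tail K zero    = suc K ∷ [] , n<1+n K ∷ [] , [] ∷ [] , refl
      distinct-tail K (suc n) with distinct-tail K n | special K n
      ... | L , L> , distinct , len | i , j , K<i , K<j , same , ¬same = extend (new L distinct)
        where
        New : List ℕ → ℕ → Set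
        New L k = All (λ l → ¬ SameBlock a (suc (suc n)) k l) L
        fresh : ∀ {k} L → All (λ l → ¬ SameBlock a (suc n) k l) L → New L k
        fresh L = All.map (λ ¬s s → ¬s (SameBlock-≤ (n≤1+n _) s))
        -- As the list is `Distinct`, at most one entry `l` shares the first `suc n` letters of `i`
        -- and `j`, and the next letter after `l` cannot agree with both.
        new : ∀ L → Distinct a (suc n) L → New L i ⊎ New L j
        new []      _            = inj₁ []
        new (l ∷ L) (l∉L ∷ distinct) with em {SameBlock a (suc n) l i}
        ... | no ¬l with new L distinct
        ...   | inj₁ i∉L = inj₁ ((λ s → ¬l (SameBlock-≤ (n≤1+n _) (SameBlock-sym s))) ∷ i∉L)
        ...   | inj₂ j∉L = inj₂ ((λ s → ¬l (SameBlock-trans (SameBlock-sym (SameBlock-≤ (n≤1+n _) s)) (SameBlock-sym same))) ∷ j∉L)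
        new (l ∷ L) (l∉L ∷ distinct) | yes l~i with em {SameBlock a (suc (suc n)) i l}
        ... | no ¬i = inj₁ (¬i ∷ fresh L (All.map (λ ¬s s → ¬s (SameBlock-trans l~i s)) l∉L))
        ... | yes i~l = inj₂ ((λ s → ¬same (SameBlock-trans i~l (SameBlock-sym s))) ∷
                fresh L (All.map (λ ¬s s → ¬s (SameBlock-trans (SameBlock-trans l~i same) s)) l∉L))
        longer : Distinct a (suc (suc n)) L
        longer = AllPairs.map (λ ¬s s → ¬s (SameBlock-≤ (n≤1+n _) s)) distinct
        extend : New L i ⊎ New L j → ∃ λ L → All (K <_) L × Distinct a (suc (suc n)) L × length L ≡ suc (suc n)
        extend (inj₁ i∉L) = i ∷ L , K<i ∷ L> , i∉L ∷ longer , cong suc len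
        extend (inj₂ j∉L) = j ∷ L , K<j ∷ L> , j∉L ∷ longer , cong suc len

      -- For `n` large, the block at a position up to `K` never occurs later, so the position can be
      -- put in front of any list of later ones. Positions are added from `K` down to 1.
      distinct-prefix : ∀ K → ∃ λ N → ∀ n → N ≤ n → ∀ L → All (K <_) L → Distinct a n L →
                        ∃ λ L′ → Distinct a n L′ × length L′ ≡ K + length L
      distinct-prefix zero    = 0 , λ n _ L _ distinct → L , distinct , refl
      distinct-prefix (suc K) with distinct-prefix K | ¬Recurrent⇒neverRecurs a (suc K) (¬rec K)
      ... | N , prefix | N′ , never = N ⊔ N′ , λ n N≤n L L> distinct →
        let L′ , distinct′ , len = prefix n (m⊔n≤o⇒m≤o N N′ N≤n) (suc K ∷ L) (n<1+n K ∷ All.map (<-trans (n<1+n K)) L>)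
              (All.map (λ {l} K<l s → never l K<l (SameBlock-≤ (m⊔n≤o⇒n≤o N N′ N≤n) s)) L> ∷ distinct)
        in L′ , distinct′ , trans len (+-suc K (length L))

      complexity-≥ : ∀ K → ∃ λ N → ∀ n → N ≤ n → K + n ≤ p n
      complexity-≥ K with distinct-prefix K
      -- The threshold `suc N` forces the length to be positive, as `distinct-tail` requires.
      ... | N , prefix = suc N , λ where
        (suc n) N<n → let L , L> , distinct , len = distinct-tail K n
                          L′ , distinct′ , len′ = prefix (suc n) (<⇒≤ N<n) L L> distinct
                      in subst (_≤ p (suc n)) (trans len′ (cong (K +_) len))
                           (Distinct⇒length≤ cf L′ (complexity (suc n) (s≤s z≤n)) distinct′)

-- Continuants modulo an integer.

module Continuants where

  open import Data.Fin using (Fin; toℕ; fromℕ<; combine)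
  open import Data.Fin.Properties using (pigeonhole; fromℕ<-injective; combine-injective)
  open import Data.Integer as ℤ using (ℤ; +_; -_)
  open import Data.Integer.DivMod using (_%ℕ_; _/ℕ_; n%ℕd<d; a≡a%ℕn+[a/ℕn]*n)
  open import Data.Integer.Divisibility.Signed using (_∣_; divides; ∣m∣n⇒∣m-n; ∣m⇒∣-m; ∣m⇒∣m*n; ∣n⇒∣m*n)
  open import Data.Integer.Tactic.RingSolver using (solve-∀)
  open import Data.Nat
  open import Data.Nat.Properties
  open Words using (SameBlock; SameBlock-≤; Recurrent)

  step : ℕ → ℤ × ℤ → ℤ × ℤ
  step c (x , y) = (+ c ℤ.* x ℤ.+ y , x)

  -- row a (1 , 0) n = (qₙ , qₙ₋₁) and row a (a₀ , 1) n = (pₙ , pₙ₋₁)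
  row : (ℕ → ℕ) → ℤ × ℤ → ℕ → ℤ × ℤ
  row a r zero    = r
  row a r (suc n) = step (a n) (row a r n)

  infix 4 _≋_[mod_]
  _≋_[mod_] : ℤ × ℤ → ℤ × ℤ → ℕ → Set
  (x , y) ≋ (x′ , y′) [mod m ] = (+ m ∣ x ℤ.- x′) × (+ m ∣ y ℤ.- y′)

  -- A step is an integer matrix of determinant -1, hence invertible for every modulus: `y` is
  -- `(c x + y) - c x`.
  step-cancel : ∀ {m} c r r′ → step c r ≋ step c r′ [mod m ] → r ≋ r′ [mod m ]
  step-cancel c (x , y) (x′ , y′) (h , h′) =
    h′ , subst (_ ∣_) (eq (+ c) x y x′ y′) (∣m∣n⇒∣m-n h (∣n⇒∣m*n (+ c) h′))
    where
    eq : ∀ c x y x′ y′ → ((c ℤ.* x ℤ.+ y) ℤ.- (c ℤ.* x′ ℤ.+ y′)) ℤ.- c ℤ.* (x ℤ.- x′) ≡ y ℤ.- y′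
    eq = solve-∀

  -- The last `s` steps on both sides read the same letters, so they can be undone in parallel, last
  -- letter first.
  row-cancel : ∀ {m} a r s i j → SameBlock a s i j →
               row a r (i + s) ≋ row a r (j + s) [mod m ] → row a r i ≋ row a r j [mod m ]
  row-cancel a r zero    i j same h = subst₂ (λ k l → row a r k ≋ row a r l [mod _ ]) (+-identityʳ i) (+-identityʳ j) h
  row-cancel {m} a r (suc s) i j same h = row-cancel a r s i j (SameBlock-≤ (n≤1+n s) same)
    (step-cancel (a (i + s)) _ _
      (subst (λ c → step (a (i + s)) (row a r (i + s)) ≋ step c (row a r (j + s)) [mod m ])
        (sym (SameBlock.letter same s (n<1+n s)))
        (subst₂ (λ k l → row a r k ≋ row a r l [mod m ]) (+-suc i s) (+-suc j s) h)))

  %ℕ≡⇒∣- : ∀ x y m .{{_ : NonZero m}} → x %ℕ m ≡ y %ℕ m → + m ∣ x ℤ.- y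
  %ℕ≡⇒∣- x y m eq = divides (x /ℕ m ℤ.- y /ℕ m) (begin
    x ℤ.- y
      ≡⟨ cong₂ ℤ._-_ (a≡a%ℕn+[a/ℕn]*n x m) (a≡a%ℕn+[a/ℕn]*n y m) ⟩
    (+ (x %ℕ m) ℤ.+ x /ℕ m ℤ.* + m) ℤ.- (+ (y %ℕ m) ℤ.+ y /ℕ m ℤ.* + m)
      ≡⟨ cong (λ r → (+ r ℤ.+ x /ℕ m ℤ.* + m) ℤ.- (+ (y %ℕ m) ℤ.+ y /ℕ m ℤ.* + m)) eq ⟩
    (+ (y %ℕ m) ℤ.+ x /ℕ m ℤ.* + m) ℤ.- (+ (y %ℕ m) ℤ.+ y /ℕ m ℤ.* + m)
      ≡⟨ ring (+ (y %ℕ m)) (x /ℕ m) (y /ℕ m) (+ m) ⟩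
    (x /ℕ m ℤ.- y /ℕ m) ℤ.* + m ∎)
    where
    open ≡-Reasoning
    ring : ∀ r u v m → (r ℤ.+ u ℤ.* m) ℤ.- (r ℤ.+ v ℤ.* m) ≡ (u ℤ.- v) ℤ.* m
    ring = solve-∀

  residue : ∀ m .{{_ : NonZero m}} → ℤ → Fin m
  residue m x = fromℕ< (n%ℕd<d x m)

  residue≡⇒∣- : ∀ x y m .{{_ : NonZero m}} → residue m x ≡ residue m y → + m ∣ x ℤ.- y
  residue≡⇒∣- x y m eq = %ℕ≡⇒∣- x y m (fromℕ<-injective _ _ (n%ℕd<d x m) (n%ℕd<d y m) eq)

  pigeonhole-mod : ∀ m .{{_ : NonZero m}} (f : ℕ → ℤ × ℤ) → ∃₂ λ i j → i < j × f i ≋ f j [mod m ]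
  pigeonhole-mod m f with pigeonhole (n<1+n (m * m)) (λ i → combine (residue m (x i)) (residue m (y i)))
    where
    x y : Fin (suc (m * m)) → ℤ
    x i = proj₁ (f (toℕ i))
    y i = proj₂ (f (toℕ i))
  ... | i , j , i<j , eq with combine-injective {m} {m} _ _ _ _ eq
  ...   | eq₁ , eq₂ = toℕ i , toℕ j , i<j ,
    residue≡⇒∣- (proj₁ (f (toℕ i))) (proj₁ (f (toℕ j))) m eq₁ ,
    residue≡⇒∣- (proj₂ (f (toℕ i))) (proj₂ (f (toℕ j))) m eq₂

  -- Each return time is followed by all the letters read since V, so any sum of consecutive
  -- return times is a return time again.
  module _ (a : ℕ → ℕ) (V : ℕ) (rec : Recurrent a V) where

    elapsed : ℕ → ℕ
    elapsed zero    = 0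
    elapsed (suc j) = proj₁ (rec (elapsed j)) + elapsed j

    elapsed-between : ℕ → ℕ → ℕ
    elapsed-between i zero    = 0
    elapsed-between i (suc m) = proj₁ (rec (elapsed (m + i))) + elapsed-between i m

    elapsed-split : ∀ i m → elapsed (m + i) ≡ elapsed-between i m + elapsed i
    elapsed-split i zero    = refl
    elapsed-split i (suc m) = trans (cong (λ s → proj₁ (rec (elapsed (m + i))) + s) (elapsed-split i m))
      (sym (+-assoc (proj₁ (rec (elapsed (m + i)))) (elapsed-between i m) (elapsed i)))

    return-between : ∀ i m → SameBlock a (elapsed i) (elapsed-between i m + V) V
    return-between i zero    .SameBlock.letter t _   = refl
    return-between i (suc m) .SameBlock.letter t t<S = begin
      a ((k + D) + V + t)   ≡⟨ cong a (trans (cong (_+ t) (swapʳ k D V)) (+-assoc (k + V) D t)) ⟩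
      -- The newest return preserves `elapsed (m + i)` letters: the `D` letters of the earlier
      -- returns and `elapsed i` more.
      a ((k + V) + (D + t)) ≡⟨ SameBlock.letter (proj₂ (proj₂ (rec _))) (D + t) D+t<S ⟩
      a (V + (D + t))       ≡⟨ cong a (trans (sym (+-assoc V D t)) (cong (_+ t) (+-comm V D))) ⟩
      a (D + V + t)         ≡⟨ SameBlock.letter (return-between i m) t t<S ⟩
      a (V + t)             ∎
      where
      open ≡-Reasoning
      k = proj₁ (rec (elapsed (m + i)))
      D = elapsed-between i m
      D+t<S : D + t < elapsed (m + i)
      D+t<S = subst (D + t <_) (sym (elapsed-split i m)) (+-monoʳ-< D t<S)
      swapʳ : ∀ k D V → (k + D) + V ≡ (k + V) + D
      swapʳ k D V = trans (+-assoc k D V) (trans (cong (λ s → k + s) (+-comm D V)) (sym (+-assoc k V D)))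

    -- Two of the rows at the indices `V + elapsed j` agree modulo `m`. The larger index lies
    -- `elapsed i` letters after `D + V`, and these letters repeat those after `V`. Undoing them
    -- leaves the indices `D + V` and `V`.
    row-returns : ∀ r m .{{_ : NonZero m}} → ∃ λ K → V < K × row a r K ≋ row a r V [mod m ]
    row-returns r m with pigeonhole-mod m (λ j → row a r (V + elapsed j))
    ... | i , j , i<j , h with j ∸ i in eq | m<n⇒0<n∸m i<j
    -- The form `suc n` exposes one return time inside `D`; it is at least 1, whence `V < D + V`.
    ...   | suc n | _ = D + V , m<n+m V (≤-trans (proj₁ (proj₂ (rec (elapsed (n + i))))) (m≤m+n _ _)) ,
      row-cancel a r (elapsed i) (D + V) V (return-between i (suc n))
        (subst (λ k → row a r k ≋ row a r (V + elapsed i) [mod m ]) eq′ (sym≋ {r₁} {r₂} h))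
      where
      D = elapsed-between i (suc n)
      eq′ : V + elapsed j ≡ D + V + elapsed i
      eq′ = begin
        V + elapsed j           ≡⟨ cong (λ k → V + elapsed k) (sym (trans (cong (_+ i) (sym eq)) (m∸n+n≡m (<⇒≤ i<j)))) ⟩
        V + elapsed (suc n + i) ≡⟨ cong (λ s → V + s) (elapsed-split i (suc n)) ⟩
        V + (D + elapsed i)     ≡⟨ sym (+-assoc V D _) ⟩
        V + D + elapsed i       ≡⟨ cong (_+ elapsed i) (+-comm V D) ⟩
        D + V + elapsed i       ∎
        where open ≡-Reasoning
      swap : ∀ x y → - (x ℤ.- y) ≡ y ℤ.- x
      swap = solve-∀
      r₁ = row a r (V + elapsed i)
      r₂ = row a r (V + elapsed j)
      sym≋ : ∀ {r r′} → r ≋ r′ [mod m ] → r′ ≋ r [mod m ]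
      sym≋ {x , y} {x′ , y′} (h , h′) = subst (_ ∣_) (swap x x′) (∣m⇒∣-m h) , subst (_ ∣_) (swap y y′) (∣m⇒∣-m h′)

  wedge : (r r′ : ℤ × ℤ) → ℤ
  wedge (x , y) (x′ , y′) = x ℤ.* y′ ℤ.- y ℤ.* x′

  -- The wedge is a determinant, bilinear and alternating, so replacing `r` by `r - r′` does not
  -- change it.
  wedge-∣ : ∀ {m} r r′ → r ≋ r′ [mod m ] → + m ∣ wedge r r′
  wedge-∣ (x , y) (x′ , y′) (h , h′) = subst (_ ∣_) (eq x y x′ y′)
    (∣m∣n⇒∣m-n (∣m⇒∣m*n y′ h) (∣m⇒∣m*n x′ h′))
    where
    eq : ∀ x y x′ y′ → (x ℤ.- x′) ℤ.* y′ ℤ.- (y ℤ.- y′) ℤ.* x′ ≡ x ℤ.* y′ ℤ.- y ℤ.* x′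
    eq = solve-∀

-- Diophantine approximation by convergents.

module Approximation where

  open import Data.Integer as ℤ using (ℤ; +_; -[1+_])
  import Data.Integer.Divisibility.Signed as ℤ
  import Data.Integer.Properties as ℤ
  import Data.Integer.Tactic.RingSolver as ℤSolver
  open import Data.Nat as ℕ using (ℕ; zero; suc)
  import Data.Nat.Divisibility as ℕ
  import Data.Nat.Properties as ℕ
  open import Data.Rational
  open import Data.Rational.Properties
  open import Data.Rational.Solver using (module +-*-Solver)
  open import Data.Rational.Unnormalised using (mkℚᵘ)
  import Data.Rational.Unnormalised as ℚᵘ
  import Data.Rational.Unnormalised.Properties as ℚᵘ
  open Words using (Recurrent)
  open Continuants

  ι : ℤ → ℚ
  ι i = i / 1

  toℚᵘ-ι : ∀ i → toℚᵘ (ι i) ℚᵘ.≃ mkℚᵘ i 0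
  toℚᵘ-ι i = toℚᵘ-fromℚᵘ (mkℚᵘ i 0)

  -- Normalised fractions do not compute on variables. The identity is checked on unnormalised
  -- fractions, where it is integer arithmetic, and carried back; the same method serves below.
  ι-homo-+ : ∀ i j → ι (i ℤ.+ j) ≡ ι i + ι j
  ι-homo-+ i j = toℚᵘ-injective (begin-equality
    toℚᵘ (ι (i ℤ.+ j))           ≃⟨ toℚᵘ-ι (i ℤ.+ j) ⟩
    mkℚᵘ (i ℤ.+ j) 0             ≃⟨ ℚᵘ.*≡* (cong (ℤ._* + 1) (sym (cong₂ ℤ._+_ (ℤ.*-identityʳ i) (ℤ.*-identityʳ j)))) ⟩
    mkℚᵘ i 0 ℚᵘ.+ mkℚᵘ j 0       ≃⟨ ℚᵘ.≃-sym (ℚᵘ.+-cong (toℚᵘ-ι i) (toℚᵘ-ι j)) ⟩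
    toℚᵘ (ι i) ℚᵘ.+ toℚᵘ (ι j)   ≃⟨ ℚᵘ.≃-sym (toℚᵘ-homo-+ (ι i) (ι j)) ⟩
    toℚᵘ (ι i + ι j)             ∎)
    where open ℚᵘ.≤-Reasoning

  ι-homo-* : ∀ i j → ι (i ℤ.* j) ≡ ι i * ι j
  ι-homo-* i j = toℚᵘ-injective (begin-equality
    toℚᵘ (ι (i ℤ.* j))           ≃⟨ toℚᵘ-ι (i ℤ.* j) ⟩
    mkℚᵘ i 0 ℚᵘ.* mkℚᵘ j 0       ≃⟨ ℚᵘ.≃-sym (ℚᵘ.*-cong (toℚᵘ-ι i) (toℚᵘ-ι j)) ⟩
    toℚᵘ (ι i) ℚᵘ.* toℚᵘ (ι j)   ≃⟨ ℚᵘ.≃-sym (toℚᵘ-homo-* (ι i) (ι j)) ⟩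
    toℚᵘ (ι i * ι j)             ∎)
    where open ℚᵘ.≤-Reasoning

  ι-homo-neg : ∀ i → ι (ℤ.- i) ≡ - ι i
  ι-homo-neg i = toℚᵘ-injective (begin-equality
    toℚᵘ (ι (ℤ.- i))     ≃⟨ toℚᵘ-ι (ℤ.- i) ⟩
    ℚᵘ.- mkℚᵘ i 0        ≃⟨ ℚᵘ.≃-sym (ℚᵘ.-‿cong (toℚᵘ-ι i)) ⟩
    ℚᵘ.- toℚᵘ (ι i)      ≃⟨ ℚᵘ.≃-sym (toℚᵘ-homo‿- (ι i)) ⟩
    toℚᵘ (- ι i)         ∎)
    where open ℚᵘ.≤-Reasoning

  ι-homo-- : ∀ i j → ι (i ℤ.- j) ≡ ι i - ι j
  ι-homo-- i j = trans (ι-homo-+ i (ℤ.- j)) (cong (λ x → ι i + x) (ι-homo-neg j))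

  ι-mono-< : ∀ {i j} → i ℤ.< j → ι i < ι j
  ι-mono-< {i} {j} i<j = <-≤-trans
    (subst (_< ι (ℤ.suc i)) (+-identityˡ (ι i)) (subst (0ℚ + ι i <_) (sym (ι-homo-+ (+ 1) i)) (+-monoˡ-< (ι i) (positive⁻¹ 1ℚ))))
    (/1-mono (ℤ.i<j⇒suc[i]≤j i<j))

  ∣ι∣ : ∀ i → ∣ ι i ∣ ≡ ι (+ ℤ.∣ i ∣)
  ∣ι∣ (+ n)    = 0≤p⇒∣p∣≡p (/1-mono {+ 0} {+ n} (ℤ.+≤+ ℕ.z≤n))
  ∣ι∣ -[1+ n ] = trans (cong ∣_∣ (ι-homo-neg (+ suc n))) (trans (∣-p∣≡∣p∣ (ι (+ suc n))) (∣ι∣ (+ suc n)))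

  recip*ι : ∀ m .{{_ : ℕ.NonZero m}} → (+ 1 / m) * ι (+ m) ≡ 1ℚ
  recip*ι m@(suc m-1) = toℚᵘ-injective (begin-equality
    toℚᵘ ((+ 1 / m) * ι (+ m))            ≃⟨ toℚᵘ-homo-* (+ 1 / m) (ι (+ m)) ⟩
    toℚᵘ (+ 1 / m) ℚᵘ.* toℚᵘ (ι (+ m))    ≃⟨ ℚᵘ.*-cong (toℚᵘ-fromℚᵘ (mkℚᵘ (+ 1) m-1)) (toℚᵘ-ι (+ m)) ⟩
    mkℚᵘ (+ 1) m-1 ℚᵘ.* mkℚᵘ (+ m) 0      ≃⟨ ℚᵘ.*≡* (trans (ℤ.*-identityʳ _) (trans (ℤ.*-identityˡ (+ m)) (sym (trans (ℤ.*-identityˡ (+ (m ℕ.* 1))) (cong +_ (ℕ.*-identityʳ m)))))) ⟩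
    toℚᵘ 1ℚ                               ∎)
    where open ℚᵘ.≤-Reasoning

  p*↧≡↥ : ∀ p → p * ι (↧ p) ≡ ι (↥ p)
  p*↧≡↥ p@record{} = toℚᵘ-injective (begin-equality
    toℚᵘ (p * ι (↧ p))                    ≃⟨ toℚᵘ-homo-* p (ι (↧ p)) ⟩
    toℚᵘ p ℚᵘ.* toℚᵘ (ι (↧ p))            ≃⟨ ℚᵘ.*-congˡ {toℚᵘ p} (toℚᵘ-ι (↧ p)) ⟩
    toℚᵘ p ℚᵘ.* mkℚᵘ (↧ p) 0              ≃⟨ ℚᵘ.*≡* (trans (ℤ.*-identityʳ _) (cong (λ n → ↥ p ℤ.* + n) (sym (ℕ.*-identityʳ (↧ₙ p))))) ⟩
    mkℚᵘ (↥ p) 0                          ≃⟨ ℚᵘ.≃-sym (toℚᵘ-ι (↥ p)) ⟩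
    toℚᵘ (ι (↥ p))                        ∎)
    where open ℚᵘ.≤-Reasoning

  i≤∣i∣ : ∀ i → i ℤ.≤ + ℤ.∣ i ∣
  i≤∣i∣ (+ n)    = ℤ.≤-refl
  i≤∣i∣ -[1+ n ] = ℤ.-≤+

  -- The numerator of `c` is at least 1, so `|z|` times the denominator of `c` is large enough.
  archimedean : ∀ c → 0ℚ < c → ∀ (z : ℤ) → ∃ λ n → ι z ≤ c * ι (+ n)
  archimedean c@record{} 0<c z = ℤ.∣ z ∣ ℕ.* ↧ₙ c , (begin
    ι z                               ≤⟨ /1-mono z≤ ⟩
    ι (+ ℤ.∣ z ∣ ℤ.* ↥ c)             ≡⟨ ι-homo-* (+ ℤ.∣ z ∣) (↥ c) ⟩
    ι (+ ℤ.∣ z ∣) * ι (↥ c)           ≡⟨ cong (ι (+ ℤ.∣ z ∣) *_) (sym (p*↧≡↥ c)) ⟩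
    ι (+ ℤ.∣ z ∣) * (c * ι (↧ c))     ≡⟨ solve 3 (λ x y z → x :* (y :* z) := y :* (x :* z)) refl (ι (+ ℤ.∣ z ∣)) c (ι (↧ c)) ⟩
    c * (ι (+ ℤ.∣ z ∣) * ι (↧ c))     ≡⟨ cong (c *_) (sym (trans (cong ι (ℤ.pos-* ℤ.∣ z ∣ (↧ₙ c))) (ι-homo-* (+ ℤ.∣ z ∣) (↧ c)))) ⟩
    c * ι (+ (ℤ.∣ z ∣ ℕ.* ↧ₙ c))      ∎)
    where
    open ≤-Reasoning
    open +-*-Solver
    1≤↥ : + 1 ℤ.≤ ↥ c
    1≤↥ = ℤ.i<j⇒suc[i]≤j (ℤ.positive⁻¹ (↥ c) {{positive 0<c}})
    z≤ : z ℤ.≤ + ℤ.∣ z ∣ ℤ.* ↥ c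
    z≤ = ℤ.≤-trans (i≤∣i∣ z) (subst (ℤ._≤ + ℤ.∣ z ∣ ℤ.* ↥ c) (ℤ.*-identityʳ (+ ℤ.∣ z ∣)) (ℤ.*-monoˡ-≤-nonNeg (+ ℤ.∣ z ∣) 1≤↥))

  ι-wedge : ∀ r r′ → ι (wedge r r′) ≡ ι (proj₁ r) * ι (proj₂ r′) - ι (proj₂ r) * ι (proj₁ r′)
  ι-wedge (x , y) (x′ , y′) = trans (ι-homo-- (x ℤ.* y′) (y ℤ.* x′)) (cong₂ _-_ (ι-homo-* x y′) (ι-homo-* y x′))

  0≤* : ∀ {x y} → 0ℚ ≤ x → 0ℚ ≤ y → 0ℚ ≤ x * y
  0≤* {x} {y} 0≤x 0≤y = nonNegative⁻¹ (x * y) {{nonNeg*nonNeg⇒nonNeg x {{nonNegative 0≤x}} y {{nonNegative 0≤y}}}}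

  p≤p+q : ∀ {x y} → 0ℚ ≤ y → x ≤ x + y
  p≤p+q {x} {y} 0≤y = subst (_≤ x + y) (+-identityʳ x) (+-monoʳ-≤ x 0≤y)

  -- Built by composing with `suc`, as in `cfrac`, so that unfolding `cfrac` at `shift a k` gives
  -- `cfrac` at `shift a (suc k)` by definition.
  shift : ∀ {A : Set} → (ℕ → A) → ℕ → ℕ → A
  shift a zero    = a
  shift a (suc k) = shift a k ∘ suc

  shift≥1 : ∀ {a} → (∀ k → 1 ℕ.≤ a k) → ∀ k i → 1 ℕ.≤ shift a k i
  shift≥1 a≥1 zero    = a≥1
  shift≥1 a≥1 (suc k) = shift≥1 a≥1 k ∘ suc

  shift≡ : ∀ (a : ℕ → ℕ) k i → shift a k i ≡ a (k ℕ.+ i)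
  shift≡ a zero    i = refl
  shift≡ a (suc k) i = trans (shift≡ a k (suc i)) (cong a (ℕ.+-suc k i))

  1≤cfrac : ∀ b b≥1 n → 1ℚ ≤ cfrac b b≥1 n
  1≤cfrac b b≥1 zero    = /1-mono (ℤ.+≤+ (b≥1 0))
  1≤cfrac b b≥1 (suc n) = ≤-trans (/1-mono (ℤ.+≤+ (b≥1 0)))
    (subst (_≤ ι (+ b 0) + u) (+-identityʳ (ι (+ b 0))) (+-monoʳ-≤ (ι (+ b 0)) (<⇒≤ (positive⁻¹ u {{1/pos⇒pos t {{cfrac-pos (b ∘ suc) (b≥1 ∘ suc) n}}}}))))
    where
    t = cfrac (b ∘ suc) (b≥1 ∘ suc) n
    u = (1/ t) {{cfrac≢0 (b ∘ suc) (b≥1 ∘ suc) n}}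

  -- Numerators and denominators of convergents, with error estimates.

  module _ (cf : ContinuedFraction) where
    open ContinuedFraction cf

    num den : ℕ → ℤ × ℤ
    num = row a (a₀ , + 1)
    den = row a (+ 1 , + 0)

    p p′ q q′ : ℕ → ℤ
    p  = proj₁ ∘ num
    p′ = proj₂ ∘ num
    q  = proj₁ ∘ den
    q′ = proj₂ ∘ den

    1≤q : ∀ k → + 1 ℤ.≤ q k
    0≤q′ : ∀ k → + 0 ℤ.≤ q′ k
    0≤q : ∀ k → + 0 ℤ.≤ q k
    q≤aq : ∀ k → q k ℤ.≤ + a k ℤ.* q k

    0≤q k = ℤ.≤-trans (ℤ.+≤+ ℕ.z≤n) (1≤q k)
    1≤q zero    = ℤ.≤-refl
    1≤q (suc k) = ℤ.≤-trans (1≤q k) (ℤ.≤-trans (q≤aq k)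
      (subst (ℤ._≤ q (suc k)) (ℤ.+-identityʳ _) (ℤ.+-monoʳ-≤ (+ a k ℤ.* q k) (0≤q′ k))))
    0≤q′ zero    = ℤ.≤-refl
    0≤q′ (suc k) = 0≤q k
    q≤aq k = subst (ℤ._≤ + a k ℤ.* q k) (ℤ.*-identityˡ (q k))
      (ℤ.*-monoʳ-≤-nonNeg (q k) {{ℤ.nonNegative (0≤q k)}} (ℤ.+≤+ (a≥1 k)))

    q′≤q : ∀ k → q′ k ℤ.≤ q k
    q′≤q zero    = ℤ.+≤+ ℕ.z≤n
    q′≤q (suc k) = ℤ.≤-trans (q≤aq k) (subst (ℤ._≤ q (suc k)) (ℤ.+-identityʳ _) (ℤ.+-monoʳ-≤ (+ a k ℤ.* q k) (0≤q′ k)))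

    -- The summand `q (k - 1)` is at least 1. At `k = 0` strictness can fail: both denominators are
    -- 1 when the first partial quotient is 1.
    q-step-< : ∀ k → 1 ℕ.≤ k → q k ℤ.< q (suc k)
    q-step-< (suc k) _ = ℤ.suc[i]≤j⇒i<j (subst (ℤ._≤ q (suc (suc k))) (ℤ.+-comm (q (suc k)) (+ 1))
      (ℤ.+-mono-≤ (q≤aq (suc k)) (1≤q k)))

    q-mono-< : ∀ {V} K → suc V ℕ.< K → q (suc V) ℤ.< q K
    q-mono-< {V} (suc K) (ℕ.s≤s V≤K) with ℕ.m≤n⇒m<n∨m≡n V≤K
    ... | inj₁ V<K  = ℤ.<-trans (q-mono-< K V<K) (q-step-< K (ℕ.≤-trans (ℕ.s≤s ℕ.z≤n) V≤K))
    ... | inj₂ refl = q-step-< K (ℕ.s≤s ℕ.z≤n)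

    -- Each step has determinant -1 and only flips the sign.
    determinant : ∀ k → ℤ.∣ q k ℤ.* p′ k ℤ.- q′ k ℤ.* p k ∣ ≡ 1
    determinant zero    = refl
    determinant (suc k) = trans (cong ℤ.∣_∣ (eq (+ a k) (q k) (q′ k) (p k) (p′ k)))
      (trans (ℤ.∣-i∣≡∣i∣ (q k ℤ.* p′ k ℤ.- q′ k ℤ.* p k)) (determinant k))
      where
      eq : ∀ c x y z w → (c ℤ.* x ℤ.+ y) ℤ.* z ℤ.- x ℤ.* (c ℤ.* z ℤ.+ w) ≡ ℤ.- (x ℤ.* w ℤ.- y ℤ.* z)
      eq = ℤSolver.solve-∀

    -- q_K is coprime to q_{K-1}, so if the wedge vanished it would divide q_V < q_K.
    wedge-≢0 : ∀ {V} K → suc V ℕ.< K → ¬ wedge (den K) (den (suc V)) ≡ + 0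
    wedge-≢0 {V} K V<K w≡0 = ℤ.<⇒≱ (q-mono-< K V<K) qK≤qV
      where
      δ = q K ℤ.* p′ K ℤ.- q′ K ℤ.* p K
      ring : ∀ x y z w u v → (x ℤ.* w ℤ.- y ℤ.* z) ℤ.* u ≡ (w ℤ.* u ℤ.- z ℤ.* v) ℤ.* x ℤ.+ z ℤ.* (x ℤ.* v ℤ.- y ℤ.* u)
      ring = ℤSolver.solve-∀
      u = q (suc V)
      v = q′ (suc V)
      -- Coprimality enters through `δ`, which is 1 or -1: by `ring`, `δ * u` is a multiple of `q K`
      -- plus `p K` times the vanishing wedge.
      qK∣ : q K ℤ.∣ δ ℤ.* u
      qK∣ = ℤ.divides (p′ K ℤ.* u ℤ.- p K ℤ.* v) (trans (ring (q K) (q′ K) (p K) (p′ K) u v)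
        (trans (cong (λ w → (p′ K ℤ.* u ℤ.- p K ℤ.* v) ℤ.* q K ℤ.+ p K ℤ.* w) w≡0)
          (trans (cong (λ w → (p′ K ℤ.* u ℤ.- p K ℤ.* v) ℤ.* q K ℤ.+ w) (ℤ.*-zeroʳ (p K))) (ℤ.+-identityʳ _))))
      ∣qK∣∣∣u∣ : ℤ.∣ q K ∣ ℕ.∣ ℤ.∣ u ∣
      ∣qK∣∣∣u∣ = subst (ℤ.∣ q K ∣ ℕ.∣_) (trans (ℤ.abs-* δ u) (trans (cong (ℕ._* ℤ.∣ u ∣) (determinant K)) (ℕ.*-identityˡ _))) (ℤ.∣⇒∣ᵤ qK∣)
      instance
        u≢0 : ℕ.NonZero ℤ.∣ u ∣
        u≢0 = ℕ.>-nonZero (ℤ.drop‿+≤+ (subst (+ 1 ℤ.≤_) (sym (ℤ.0≤i⇒+∣i∣≡i (0≤q (suc V)))) (1≤q (suc V))))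
      qK≤qV : q K ℤ.≤ u
      qK≤qV = subst₂ ℤ._≤_ (ℤ.0≤i⇒+∣i∣≡i (0≤q K)) (ℤ.0≤i⇒+∣i∣≡i (0≤q (suc V))) (ℤ.+≤+ (ℕ.∣⇒≤ ∣qK∣∣∣u∣))

    -- t = [aₖ₊₁ ; aₖ₊₂ , … , aₖ₊ⱼ₊₁]
    tail-value : ∀ k j → ∃ λ t → 1ℚ ≤ t ×
      (ι (q k) * t + ι (q′ k)) * convergent cf (suc (k ℕ.+ j)) ≡ ι (p k) * t + ι (p′ k)
    tail-value k j = t k j , 1≤cfrac _ _ j , eq k j
      where
      open +-*-Solver
      t : ∀ k j → ℚ
      t k j = cfrac (shift a k) (shift≥1 a≥1 k) j
      u : ∀ k j → ℚ
      u k j = (1/ t k j) {{cfrac≢0 (shift a k) (shift≥1 a≥1 k) j}}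
      t*u : ∀ k j → t k j * u k j ≡ 1ℚ
      t*u k j = *-inverseʳ (t k j) {{cfrac≢0 (shift a k) (shift≥1 a≥1 k) j}}
      -- The ring solver does not know that `u` is inverse to `t`; the defect `1ℚ - t * u` is kept
      -- explicit and removed by `vanish`.
      ring : ∀ c x y t u X → ((c * x + y) * t + x) * X ≡ t * ((x * (c + u) + y) * X) + x * X * (1ℚ - t * u)
      ring = solve 6 (λ c x y t u X → ((c :* x :+ y) :* t :+ x) :* X := t :* ((x :* (c :+ u) :+ y) :* X) :+ x :* X :* (con 1ℚ :- t :* u)) refl
      ring′ : ∀ c x y t u → (c * x + y) * t + x ≡ t * (x * (c + u) + y) + x * (1ℚ - t * u)
      ring′ = solve 5 (λ c x y t u → (c :* x :+ y) :* t :+ x := t :* (x :* (c :+ u) :+ y) :+ x :* (con 1ℚ :- t :* u)) refl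
      vanish : ∀ x z k j → z + x * (1ℚ - t k j * u k j) ≡ z
      vanish x z k j = trans (cong (λ w → z + x * (1ℚ - w)) (t*u k j)) (trans (cong (λ w → z + w) (*-zeroʳ x)) (+-identityʳ z))
      ι-step : ∀ k (r : ℤ × ℤ) → ι (proj₁ (step (a k) r)) ≡ ι (+ a k) * ι (proj₁ r) + ι (proj₂ r)
      ι-step k (x , y) = trans (ι-homo-+ (+ a k ℤ.* x) y) (cong (_+ ι y) (ι-homo-* (+ a k) x))
      head : ∀ k → shift a k 0 ≡ a k
      head k = trans (shift≡ a k 0) (cong a (ℕ.+-identityʳ k))
      eq : ∀ k j → (ι (q k) * t k j + ι (q′ k)) * convergent cf (suc (k ℕ.+ j)) ≡ ι (p k) * t k j + ι (p′ k)
      eq zero j = trans (solve 3 (λ t u z → (con 1ℚ :* t :+ con 0ℚ) :* (z :+ u) := z :* t :+ t :* u) refl (t 0 j) (u 0 j) (ι a₀))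
        (cong (λ w → ι a₀ * t 0 j + w) (t*u 0 j))
      -- The induction lengthens the tail: `t k (suc j)` is `ι (+ a k) + u′`, and multiplying the
      -- identity for `k` and `suc j` by `t′` gives this one.
      eq (suc k) j = begin
        (ι (q (suc k)) * t′ + ι (q k)) * X
          ≡⟨ cong (λ w → (w * t′ + ι (q k)) * X) (ι-step k (den k)) ⟩
        ((ι (+ a k) * ι (q k) + ι (q′ k)) * t′ + ι (q k)) * X
          ≡⟨ ring (ι (+ a k)) (ι (q k)) (ι (q′ k)) t′ u′ X ⟩
        t′ * ((ι (q k) * (ι (+ a k) + u′) + ι (q′ k)) * X) + ι (q k) * X * (1ℚ - t′ * u′)
          ≡⟨ vanish (ι (q k) * X) _ (suc k) j ⟩
        t′ * ((ι (q k) * (ι (+ a k) + u′) + ι (q′ k)) * X)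
          ≡⟨ cong (t′ *_) eqₖ ⟩
        t′ * (ι (p k) * (ι (+ a k) + u′) + ι (p′ k))
          ≡⟨ sym (vanish (ι (p k)) _ (suc k) j) ⟩
        t′ * (ι (p k) * (ι (+ a k) + u′) + ι (p′ k)) + ι (p k) * (1ℚ - t′ * u′)
          ≡⟨ sym (ring′ (ι (+ a k)) (ι (p k)) (ι (p′ k)) t′ u′) ⟩
        (ι (+ a k) * ι (p k) + ι (p′ k)) * t′ + ι (p k)
          ≡⟨ cong (λ w → w * t′ + ι (p k)) (sym (ι-step k (num k))) ⟩
        ι (p (suc k)) * t′ + ι (p k)
          ∎
        where
        open ≡-Reasoning
        t′ = t (suc k) j
        u′ = u (suc k) j
        X  = convergent cf (suc (suc k ℕ.+ j))
        eqₖ : (ι (q k) * (ι (+ a k) + u′) + ι (q′ k)) * X ≡ ι (p k) * (ι (+ a k) + u′) + ι (p′ k)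
        eqₖ = subst₂ (λ n c → (ι (q k) * (ι (+ c) + u′) + ι (q′ k)) * convergent cf (suc n) ≡ ι (p k) * (ι (+ c) + u′) + ι (p′ k))
          (ℕ.+-suc k j) (head k) (eq k (suc j))

    module _ (k : ℕ) {v v′ : ℤ} (0≤v : + 0 ℤ.≤ v) (0≤v′ : + 0 ℤ.≤ v′) where

      private
        x = ι (q k)
        y = ι (q′ k)
        z = ι (p k)
        z′ = ι (p′ k)
        r = ι v
        s = ι v′
        0≤x : 0ℚ ≤ x
        0≤x = /1-mono (0≤q k)
        0≤y : 0ℚ ≤ y
        0≤y = /1-mono (0≤q′ k)
        0≤r : 0ℚ ≤ r
        0≤r = /1-mono 0≤v
        0≤s : 0ℚ ≤ s
        0≤s = /1-mono 0≤v′

      ∣ι-determinant∣ : ∣ x * z′ - y * z ∣ ≡ 1ℚ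
      ∣ι-determinant∣ = trans (cong ∣_∣ (sym (ι-wedge (den k) (num k))))
        (trans (∣ι∣ (wedge (den k) (num k))) (cong (ι ∘ +_) (determinant k)))

      -- By `tail-value`, multiplying the error by `x * t + y` leaves the determinant times
      -- `s + r * t`. Since `t` is at least 1, this is at most `(r + s) * t` in absolute value, and
      -- `t` cancels.
      wedge-error : ∀ j → x * ∣ (x * s - y * r) * convergent cf (suc (k ℕ.+ j)) - (z * s - z′ * r) ∣ ≤ r + s
      wedge-error j with tail-value k j
      ... | t , 1≤t , eq = *-cancelʳ-≤-pos t (begin
        x * E * t             ≡⟨ trans (*-assoc x E t) (trans (cong (x *_) (*-comm E t)) (sym (*-assoc x t E))) ⟩
        x * t * E             ≤⟨ *-monoʳ-≤-nonNeg E {{∣-∣-nonNeg err}} (p≤p+q {x * t} 0≤y) ⟩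
        (x * t + y) * E       ≡⟨ cong (_* E) (sym (0≤p⇒∣p∣≡p (≤-trans (0≤* 0≤x 0≤t) (p≤p+q 0≤y)))) ⟩
        ∣ x * t + y ∣ * E     ≡⟨ sym (∣p*q∣≡∣p∣*∣q∣ (x * t + y) err) ⟩
        ∣ (x * t + y) * err ∣   ≡⟨ cong ∣_∣ (ring x y z z′ r s t X) ⟩
        ∣ (x * z′ - y * z) * (s + r * t) + (x * s - y * r) * ((x * t + y) * X - (z * t + z′)) ∣
                              ≡⟨ cong ∣_∣ (trans (cong (λ u → (x * z′ - y * z) * (s + r * t) + (x * s - y * r) * u) eq0)
                                   (trans (cong (λ u → (x * z′ - y * z) * (s + r * t) + u) (*-zeroʳ (x * s - y * r))) (+-identityʳ _))) ⟩
        ∣ (x * z′ - y * z) * (s + r * t) ∣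
                              ≡⟨ ∣p*q∣≡∣p∣*∣q∣ (x * z′ - y * z) (s + r * t) ⟩
        ∣ x * z′ - y * z ∣ * ∣ s + r * t ∣
                              ≡⟨ cong₂ _*_ ∣ι-determinant∣ (0≤p⇒∣p∣≡p (≤-trans 0≤s (p≤p+q (0≤* 0≤r 0≤t)))) ⟩
        1ℚ * (s + r * t)      ≡⟨ *-identityˡ _ ⟩
        s + r * t             ≤⟨ +-monoˡ-≤ (r * t) (subst (_≤ s * t) (*-identityʳ s) (*-monoˡ-≤-nonNeg s {{nonNegative 0≤s}} 1≤t)) ⟩
        s * t + r * t         ≡⟨ sym (trans (*-distribʳ-+ t r s) (+-comm (r * t) (s * t))) ⟩
        (r + s) * t           ∎)
        where
        open ≤-Reasoning
        open +-*-Solver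
        X = convergent cf (suc (k ℕ.+ j))
        err = (x * s - y * r) * X - (z * s - z′ * r)
        E = ∣ err ∣
        0≤t : 0ℚ ≤ t
        0≤t = ≤-trans (nonNegative⁻¹ 1ℚ) 1≤t
        instance
          t-pos : Positive t
          t-pos = positive (<-≤-trans (positive⁻¹ 1ℚ) 1≤t)
        eq0 : (x * t + y) * X - (z * t + z′) ≡ 0ℚ
        eq0 = trans (cong (_- (z * t + z′)) eq) (+-inverseʳ (z * t + z′))
        ring : ∀ x y z z′ r s t X → (x * t + y) * ((x * s - y * r) * X - (z * s - z′ * r)) ≡
               (x * z′ - y * z) * (s + r * t) + (x * s - y * r) * ((x * t + y) * X - (z * t + z′))
        ring = solve 8 (λ x y z z′ r s t X → (x :* t :+ y) :* ((x :* s :- y :* r) :* X :- (z :* s :- z′ :* r)) :=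
               (x :* z′ :- y :* z) :* (s :+ r :* t) :+ (x :* s :- y :* r) :* ((x :* t :+ y) :* X :- (z :* t :+ z′))) refl

      ∣wedge∣≤ : ∣ x * s - y * r ∣ ≤ (r + s) * x
      ∣wedge∣≤ = begin
        ∣ x * s - y * r ∣         ≤⟨ ∣p-q∣≤∣p∣+∣q∣ (x * s) (y * r) ⟩
        ∣ x * s ∣ + ∣ y * r ∣     ≡⟨ cong₂ _+_ (0≤p⇒∣p∣≡p (0≤* 0≤x 0≤s)) (0≤p⇒∣p∣≡p (0≤* 0≤y 0≤r)) ⟩
        x * s + y * r             ≤⟨ +-monoʳ-≤ (x * s) (*-monoʳ-≤-nonNeg r {{nonNegative 0≤r}} (/1-mono (q′≤q k))) ⟩
        x * s + x * r             ≡⟨ solve 3 (λ x r s → x :* s :+ x :* r := (r :+ s) :* x) refl x r s ⟩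
        (r + s) * x               ∎
        where
        open ≤-Reasoning
        open +-*-Solver

      -- The wedge grows at most like `q k` and its error decays like `1 / q k`, so the product has
      -- a bound free of `k`.
      wedge-approximates : ∀ j →
        ι (+ ℤ.∣ wedge (den k) (v , v′) ∣) *
          ∣ ι (wedge (den k) (v , v′)) * convergent cf (suc (k ℕ.+ j)) - ι (wedge (num k) (v , v′)) ∣
        ≤ ι ((v ℤ.+ v′) ℤ.* (v ℤ.+ v′))
      wedge-approximates j = begin
        ι (+ ℤ.∣ n ∣) * ∣ ι n * X - ι m ∣
          ≡⟨ cong₂ _*_ (trans (sym (∣ι∣ n)) (cong ∣_∣ n≡)) (cong ∣_∣ (cong₂ (λ a b → a * X - b) n≡ m≡)) ⟩
        ∣ x * s - y * r ∣ * E
          ≤⟨ *-monoʳ-≤-nonNeg E {{∣-∣-nonNeg err}} ∣wedge∣≤ ⟩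
        (r + s) * x * E
          ≡⟨ *-assoc (r + s) x E ⟩
        (r + s) * (x * E)
          ≤⟨ *-monoˡ-≤-nonNeg (r + s) {{nonNegative (≤-trans 0≤r (p≤p+q 0≤s))}} (wedge-error j) ⟩
        (r + s) * (r + s)
          ≡⟨ sym (trans (ι-homo-* (v ℤ.+ v′) (v ℤ.+ v′)) (cong₂ _*_ (ι-homo-+ v v′) (ι-homo-+ v v′))) ⟩
        ι ((v ℤ.+ v′) ℤ.* (v ℤ.+ v′)) ∎
        where
        open ≤-Reasoning
        n = wedge (den k) (v , v′)
        m = wedge (num k) (v , v′)
        n≡ = ι-wedge (den k) (v , v′)
        m≡ = ι-wedge (num k) (v , v′)
        X = convergent cf (suc (k ℕ.+ j))
        err = (x * s - y * r) * X - (z * s - z′ * r)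
        E = ∣ err ∣

    -- Passage from convergents to α.

    eventually-near : ∀ {α} → cf IsExpansionOf α → ∀ M η → 0ℚ < η →
      ∃ λ j → ∃ λ N → ∀ n → N ℕ.≤ n → ∣ seq α n - convergent cf (suc (M ℕ.+ j)) ∣ ≤ η + η
    eventually-near {α} expansion M η 0<η with expansion η 0<η
    -- The index `suc (M + j)` is beyond `j`, so `near` applies. One `η` is the distance from the
    -- convergent to α, the other the slack in `≤ℝ`.
    ... | j , near with near (suc (M ℕ.+ j)) (ℕ.m≤n⇒m≤1+n (ℕ.m≤n+m j M))
    ... | lower , upper with lower η 0<η | upper η 0<η
    ... | N₁ , lower₁ | N₂ , upper₂ = j , N₁ ℕ.⊔ N₂ , λ n N≤n →
      abs≤ (lower₁ n (ℕ.m⊔n≤o⇒m≤o N₁ N₂ N≤n)) (upper₂ n (ℕ.m⊔n≤o⇒n≤o N₁ N₂ N≤n))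
      where
      open +-*-Solver
      abs≤ : ∀ {x y} → x - η ≤ y + η → y ≤ x + η + η → ∣ y - x ∣ ≤ η + η
      abs≤ {x} {y} l u with ∣p∣≡p∨∣p∣≡-p (y - x)
      ... | inj₁ eq = subst₂ _≤_ (sym eq) (solve 2 (λ x η → x :+ η :+ η :- x := η :+ η) refl x η) (+-monoˡ-≤ (- x) u)
      ... | inj₂ eq = subst₂ _≤_ (trans (solve 3 (λ x y η → (x :- η) :+ (η :- y) := :- (y :- x)) refl x y η) (sym eq))
        (solve 2 (λ y η → (y :+ η) :+ (η :- y) := η :+ η) refl y η) (+-monoˡ-≤ (η - y) l)

  -- The multiplier must be a natural number while `n` may be negative; in that case `- m` is the
  -- integer compared with.
  ‖‖ℚ-multiple≤ : ∀ n m x y → ‖ ι (+ ℤ.∣ n ∣) * y ‖ℚ ≤ ∣ ι n * x - ι m ∣ + ι (+ ℤ.∣ n ∣) * ∣ y - x ∣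
  ‖‖ℚ-multiple≤ n m x y = begin
    ‖ ι (+ ℤ.∣ n ∣) * y ‖ℚ                     ≤⟨ nearest n ⟩
    ∣ ι n * y - ι m ∣                          ≡⟨ cong ∣_∣ (solve 4 (λ n m x y → n :* y :- m := (n :* x :- m) :+ n :* (y :- x)) refl (ι n) (ι m) x y) ⟩
    ∣ (ι n * x - ι m) + ι n * (y - x) ∣        ≤⟨ ∣p+q∣≤∣p∣+∣q∣ (ι n * x - ι m) (ι n * (y - x)) ⟩
    ∣ ι n * x - ι m ∣ + ∣ ι n * (y - x) ∣      ≡⟨ cong (λ z → ∣ ι n * x - ι m ∣ + z) (trans (∣p*q∣≡∣p∣*∣q∣ (ι n) (y - x)) (cong (_* ∣ y - x ∣) (∣ι∣ n))) ⟩
    ∣ ι n * x - ι m ∣ + ι (+ ℤ.∣ n ∣) * ∣ y - x ∣ ∎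
    where
    open ≤-Reasoning
    open +-*-Solver
    nearest : ∀ n → ‖ ι (+ ℤ.∣ n ∣) * y ‖ℚ ≤ ∣ ι n * y - ι m ∣
    nearest (+ n)    = ‖‖ℚ-nearest (ι (+ n) * y) m
    nearest -[1+ n ] = ≤-trans (‖‖ℚ-nearest (ι (+ suc n) * y) (ℤ.- m)) (≤-reflexive
      (trans (cong (λ z → ∣ ι (+ suc n) * y - z ∣) (ι-homo-neg m))
      (trans (sym (∣-p∣≡∣p∣ (ι (+ suc n) * y - - ι m)))
      (trans (cong ∣_∣ (solve 3 (λ n y m → :- (n :* y :- (:- m)) := (:- n) :* y :- m) refl (ι (+ suc n)) y (ι m)))
             (cong (λ z → ∣ z * y - ι m ∣) (sym (ι-homo-neg (+ suc n))))))))

  multiple-lower-bound : ∀ {α 𝓓 c} → (∀ (N : ℕ) → 1 ℕ.≤ N → fromℚ c ≤ℝ (+ N / 1) • ∣ N ∣[ 𝓓 ] • ‖ (+ N / 1) • α ‖) →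
    ∀ cf → cf IsExpansionOf α → ∀ n m M b → 1 ℕ.≤ ℤ.∣ n ∣ →
    (∀ j → ι (+ ℤ.∣ n ∣) * ∣ ι n * convergent cf (suc (M ℕ.+ j)) - ι m ∣ ≤ ι b) →
    c * ι (+ e 𝓓 (w 𝓓 ℤ.∣ n ∣)) ≤ ι (b ℤ.+ + 2)
  multiple-lower-bound {α} {𝓓} {c} lower cf expansion n m M b 1≤N bound = conclude
    (eventually-near cf {α} expansion M η 0<η) (lower N 1≤N ε 0<ε)
    where
    open ≤-Reasoning
    open +-*-Solver
    N = ℤ.∣ n ∣
    q̂ = ι (+ N)
    D = e 𝓓 (w 𝓓 N)
    instance
      D≢0 : ℕ.NonZero D
      D≢0 = e≢0 𝓓 (w 𝓓 N)
      N≢0 : ℕ.NonZero N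
      N≢0 = ℕ.>-nonZero 1≤N
      2NN≢0 : ℕ.NonZero (2 ℕ.* (N ℕ.* N))
      2NN≢0 = ℕ.m*n≢0 2 (N ℕ.* N) {{_}} {{ℕ.m*n≢0 N N}}
      ιD-nonNeg : NonNegative (ι (+ D))
      ιD-nonNeg = nonNegative (/1-mono {+ 0} {+ D} (ℤ.+≤+ ℕ.z≤n))
      q̂-nonNeg : NonNegative q̂
      q̂-nonNeg = nonNegative (/1-mono {+ 0} {+ N} (ℤ.+≤+ ℕ.z≤n))
    η ε : ℚ
    -- Chosen so that replacing α by a convergent costs exactly 1 after multiplication by `N` twice.
    η = + 1 / (2 ℕ.* (N ℕ.* N))
    -- This is the pseudo-absolute value of `N` and also the slack in `≤ℝ`; multiplied by `D`, the
    -- slack costs another 1, whence `b + 2`.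
    ε = + 1 / D
    0<η : 0ℚ < η
    0<η = positive⁻¹ η {{normalize-pos 1 (2 ℕ.* (N ℕ.* N))}}
    0<ε : 0ℚ < ε
    0<ε = positive⁻¹ ε {{normalize-pos 1 D}}
    2q̂²η : q̂ * (q̂ * (η + η)) ≡ 1ℚ
    2q̂²η = trans (solve 2 (λ q η → q :* (q :* (η :+ η)) := η :* ((con 1ℚ :+ con 1ℚ) :* (q :* q))) refl q̂ η)
      (trans (cong (η *_) (sym (trans (cong ι (trans (ℤ.pos-* 2 (N ℕ.* N)) (cong (+ 2 ℤ.*_) (ℤ.pos-* N N))))
        (trans (ι-homo-* (+ 2) (+ N ℤ.* + N)) (cong ((1ℚ + 1ℚ) *_) (ι-homo-* (+ N) (+ N)))))))
      (recip*ι (2 ℕ.* (N ℕ.* N))))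
    conclude : (∃ λ j → ∃ λ N₁ → ∀ i → N₁ ℕ.≤ i → ∣ seq α i - convergent cf (suc (M ℕ.+ j)) ∣ ≤ η + η) →
      (∃ λ N₂ → ∀ i → N₂ ℕ.≤ i → c ≤ q̂ * (ε * ‖ q̂ * seq α i ‖ℚ) + ε) → c * ι (+ D) ≤ ι (b ℤ.+ + 2)
    conclude (j , N₁ , near) (N₂ , c≤) = begin
      c * ι (+ D)                                  ≤⟨ *-monoʳ-≤-nonNeg (ι (+ D)) (c≤ i (ℕ.m≤n⊔m N₁ N₂)) ⟩
      (q̂ * (ε * δ) + ε) * ι (+ D)                  ≡⟨ solve 4 (λ q ε δ D → (q :* (ε :* δ) :+ ε) :* D := (ε :* D) :* (q :* δ :+ con 1ℚ)) refl q̂ ε δ (ι (+ D)) ⟩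
      (ε * ι (+ D)) * (q̂ * δ + 1ℚ)                 ≡⟨ trans (cong (_* (q̂ * δ + 1ℚ)) (recip*ι D)) (*-identityˡ (q̂ * δ + 1ℚ)) ⟩
      q̂ * δ + 1ℚ                                   ≤⟨ +-monoˡ-≤ 1ℚ (*-monoˡ-≤-nonNeg q̂ (≤-trans (‖‖ℚ-multiple≤ n m X y)
                                                       (+-monoʳ-≤ ∣ ι n * X - ι m ∣ (*-monoˡ-≤-nonNeg q̂ (near i (ℕ.m≤m⊔n N₁ N₂)))))) ⟩
      q̂ * (∣ ι n * X - ι m ∣ + q̂ * (η + η)) + 1ℚ   ≡⟨ cong (_+ 1ℚ) (trans (*-distribˡ-+ q̂ _ _) (cong (λ z → q̂ * ∣ ι n * X - ι m ∣ + z) 2q̂²η)) ⟩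
      q̂ * ∣ ι n * X - ι m ∣ + 1ℚ + 1ℚ              ≤⟨ +-monoˡ-≤ 1ℚ (+-monoˡ-≤ 1ℚ (bound j)) ⟩
      ι b + 1ℚ + 1ℚ                                ≡⟨ trans (+-assoc (ι b) 1ℚ 1ℚ) (sym (ι-homo-+ b (+ 2))) ⟩
      ι (b ℤ.+ + 2)                                ∎
      where
      i = N₁ ℕ.⊔ N₂
      X = convergent cf (suc (M ℕ.+ j))
      y = seq α i
      δ = ‖ q̂ * y ‖ℚ

  -- The bound `b` depends only on `V`, so the modulus can be chosen after it: `n₀` makes `c * n₀`
  -- reach `b + 2`, and divisibility of the wedge by `e 𝓓 n₀` makes `E` exceed `n₀`.
  Recurrent⇒¬counterexample : ∀ {α 𝓓} → MixedLittlewoodCounterexample α 𝓓 →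
    ∀ cf → cf IsExpansionOf α → ∀ V → ¬ Recurrent (ContinuedFraction.a cf) (suc V)
  Recurrent⇒¬counterexample {α} {𝓓} (c , 0<c , lower) cf expansion V rec = <-irrefl refl (begin-strict
    c * ι (+ E)               ≤⟨ multiple-lower-bound {α} {𝓓} lower cf expansion n (wedge (num cf K) (v , v′)) K b 1≤N
                                   (wedge-approximates cf K (0≤q cf (suc V)) (0≤q′ cf (suc V))) ⟩
    ι (b ℤ.+ + 2)             ≤⟨ proj₂ (archimedean c 0<c (b ℤ.+ + 2)) ⟩
    c * ι (+ n₀)              <⟨ *-monoʳ-<-pos c {{positive 0<c}} (ι-mono-< (ℤ.+<+ n₀<E)) ⟩
    c * ι (+ E)               ∎)
    where
    open ≤-Reasoning
    v = q cf (suc V)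
    v′ = q′ cf (suc V)
    b = (v ℤ.+ v′) ℤ.* (v ℤ.+ v′)
    n₀ = proj₁ (archimedean c 0<c (b ℤ.+ + 2))
    returns = row-returns (ContinuedFraction.a cf) (suc V) rec (+ 1 , + 0) (e 𝓓 n₀) {{e≢0 𝓓 n₀}}
    K = proj₁ returns
    n = wedge (den cf K) (v , v′)
    N = ℤ.∣ n ∣
    E = e 𝓓 (w 𝓓 N)
    1≤N : 1 ℕ.≤ N
    1≤N = ℕ.n≢0⇒n>0 (λ N≡0 → wedge-≢0 cf K (proj₁ (proj₂ returns)) (ℤ.∣i∣≡0⇒i≡0 N≡0))
    n₀<E : n₀ ℕ.< E
    n₀<E = ℕ.≤-<-trans (w-max 𝓓 N {{ℕ.>-nonZero 1≤N}} n₀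
      (ℤ.∣⇒∣ᵤ (wedge-∣ {e 𝓓 n₀} (den cf K) (v , v′) (proj₂ (proj₂ returns))))) (n<e 𝓓 (w 𝓓 N))

-- Divergence of the complexity minus the length.

open import Data.Integer using (+_; _-_)
import Data.Integer as ℤ
import Data.Integer.Properties as ℤ
open import Data.Nat using (ℕ)
open import Data.Integer.Tactic.RingSolver using (solve-∀)
open Words using (complexity-≥)
open Approximation using (i≤∣i∣; Recurrent⇒¬counterexample)

corollary2p4 : ExcludedMiddle 0ℓ →
    (𝓓 : Base) (α : ℝ) →
    MixedLittlewoodCounterexample α 𝓓 →
    (cf : ContinuedFraction) → cf IsExpansionOf α →
    (p : ℕ → ℕ) → IsComplexityFunction cf p →
    (λ n → + p n - + n) ⟶+∞
corollary2p4 em 𝓓 α counterexample cf expansion p complexity M =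
  -- `M` may be negative; its absolute value serves as the number of extra blocks.
  let N , large = complexity-≥ em cf p complexity (Recurrent⇒¬counterexample {α} {𝓓} counterexample cf expansion) ℤ.∣ M ∣
  in N , λ n N≤n → ℤ.≤-trans (i≤∣i∣ M) (subst (ℤ._≤ + p n - + n) (cancel (+ ℤ.∣ M ∣) (+ n))
       (ℤ.+-monoˡ-≤ (ℤ.- + n) (ℤ.+≤+ (large n N≤n))))
  where
  cancel : ∀ i j → (i ℤ.+ j) - j ≡ i
  cancel = solve-∀
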